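{- Let $G$ and $H$ be two nontrivial graphs. Consider the following two properties. $\mathcal{P}_2(G,H)$: $\gamma(H)=1$ and $G$ is an efficient closed domination graph. $\mathcal{P}_3(G,H)$: $\delta(H)=0$, $G$ is an efficient open domination graph and $\gamma^p(G)=\gamma_t(G)$. The following statements hold. (i) $\gamma_R^p(G\circ H)\ge \max\{\gamma_R^p(G),\,2\gamma(G)\}$. (ii) $\gamma_R^p(G\circ H)=\gamma_R^p(G)$ if and only if $\gamma_R^p(G)=2\gamma^p(G)$ and either $\mathcal{P}_2(G,H)$ holds or $\mathcal{P}_3(G,H)$ holds. (iii) If $H$ has order at least three, then $\gamma_R^p(G\circ H)=2\gamma(G)$ if and only if $\gamma^p(G)=\gamma(G)$ and either $\mathcal{P}_2(G,H)$ holds or $\mathcal{P}_3(G,H)$ holds.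
   Context: All graphs are finite, simple and undirected; a graph is nontrivial if it has at least two vertices. $\delta(H)$ is the minimum degree of $H$. $N(v)$ is the open neighbourhood and $N[v]=N(v)\cup\{v\}$. $\gamma(G)$ and $\gamma^p(G)$ are, respectively, the minimum sizes of a dominating set (every vertex outside $S$ has at least one neighbour in $S$) and a perfect dominating set (every vertex outside $S$ has exactly one neighbour in $S$). For $G$ without isolated vertices, $\gamma_t(G)$ is the minimum size of a total dominating set (every vertex of $G$ has at least one neighbour in $S$). $G$ is an efficient open domination graph if there is a set $D\subseteq V(G)$ with $V(G)=\bigcup_{u\in D}N(u)$ and $N(u)\cap N(v)=\varnothing$ for all distinct $u,v\in D$ (such a $G$ has no isolated vertices). $G$ is an efficient closed domination graph if there is a dominating set $S$ of $G$ with $N[u]\cap N[v]=\varnothing$ for all distinct $u,v\in S$. A perfect Roman dominating function (PRDF) on a graph $\Gamma$ is a function $f:V(\Gamma)\to\{0,1,2\}$ such that every vertex $u$ with $f(u)=0$ is adjacent to exactly one vertex $v$ with $f(v)=2$. Its weight is $\sum_v f(v)$, and $\gamma_R^p(\Gamma)$ is the minimum weight of a PRDF on $\Gamma$. The lexicographic product $G\circ H$ has vertex set $V(G)\times V(H)$, with $(u,v)$ adjacent to $(x,y)$ iff $ux\in E(G)$, or $u=x$ and $vy\in E(H)$. -}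

module Defs where

open import Data.Nat using (ℕ; zero; suc; _*_; _^_; _≤_; z≤n; s≤s; NonZero; NonTrivial; nonTrivial⇒nonZero; >-nonZero⁻¹)
open import Data.Nat.Properties using (+-0-commutativeMonoid)
import Data.Nat.Properties as ℕ
open import Algebra.Properties.CommutativeMonoid.Sum +-0-commutativeMonoid using (sum; sum-cong-≗)
open import Data.Fin using (Fin; toℕ; fromℕ<; remQuot; finToFun; funToFin)
open import Data.Fin.Patterns using (0F; 1F; 2F)
open import Data.Fin.Properties using (any?; all?; finToFun-funToFin) renaming (_≟_ to _≟ᶠ_)
open import Data.Fin.Subset using (Subset; _∈_; _∉_; _∩_; _∪_; ⁅_⁆; ∣_∣; Empty) renaming (⊤ to full)
open import Data.Fin.Subset.Properties using (_∈?_; anySubset?; ∈⊤)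
open import Data.Product using (Σ-syntax; ∃; ∃-syntax; ∃!; _×_; _,_)
open import Data.Sum using (_⊎_; inj₁; inj₂)
open import Data.Unit using (⊤; tt)
open import Data.Vec using (tabulate)
open import Data.Vec.Properties using (lookup⇒[]=; []=⇒lookup; lookup∘tabulate)
open import Function using (_∘_)
open import Relation.Binary.Core using (Rel)
open import Relation.Binary.Definitions using (Symmetric; Irreflexive)
import Relation.Binary.Definitions as Binary
open import Relation.Binary.PropositionalEquality using (_≡_; _≢_; _≗_; refl; sym; trans; cong)
open import Relation.Nullary using (Dec; yes; no; does; contradiction)
open import Relation.Nullary.Decidable using (map′; ¬?; _×-dec_; _⊎-dec_; _→-dec_; dec-true)
open import Relation.Unary using (Decidable)
open import Level using (0ℓ)

private
  variable
    m n : ℕ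
    A : Set

record Minimum (size : A → ℕ) (P : A → Set) : Set where
  field
    value    : ℕ
    attained : ∃[ a ] (P a × size a ≡ value)
    minimal  : ∀ {a} → P a → value ≤ size a

open Minimum public using (value)

private
  least : {Q : ℕ → Set} → Decidable Q → ∀ k → Q k → ∃[ j ] (Q j × (∀ {i} → Q i → j ≤ i))
  least Q? zero q = zero , q , λ _ → z≤n
  least {Q} Q? (suc k) q with Q? zero
  ... | yes q₀ = zero , q₀ , λ _ → z≤n
  ... | no ¬q₀ with j , qj , min ← least (Q? ∘ suc) k q = suc j , qj , bound
    where
    bound : ∀ {i} → Q i → suc j ≤ i
    bound {zero}  q₀ = contradiction q₀ ¬q₀
    bound {suc i} qi = s≤s (min qi)

minimise : {size : A → ℕ} {P : A → Set} →
           (∀ k → Dec (∃[ a ] (P a × size a ≡ k))) → ∃ P → Minimum size P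
minimise {size = size} attained? (a , pa)
  with j , q , min ← least attained? (size a) (a , pa , refl)
  = record { value = j ; attained = q ; minimal = λ {b} pb → min (b , pb , refl) }

minimiseSubset : {P : Subset n → Set} → Decidable P → ∃ P → Minimum ∣_∣ P
minimiseSubset P? = minimise λ k → anySubset? λ S → P? S ×-dec (∣ S ∣ ℕ.≟ k)

record Graph (n : ℕ) : Set₁ where
  infix 4 _~_ _~?_
  field
    _~_   : Rel (Fin n) 0ℓ
    _~?_  : Binary.Decidable _~_
    sym~  : Symmetric _~_
    irr~  : Irreflexive _≡_ _~_

module _ (G : Graph n) where
  open Graph G

  N : Fin n → Subset n
  N v = tabulate λ u → does (v ~? u)

  N[_] : Fin n → Subset n
  N[ v ] = N v ∪ ⁅ v ⁆

  ∈N⇒~ : ∀ {v u} → u ∈ N v → v ~ u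
  ∈N⇒~ {v} {u} u∈ with v ~? u | trans (sym (lookup∘tabulate (λ w → does (v ~? w)) u)) ([]=⇒lookup u∈)
  ... | yes v~u | _ = v~u
  ... | no _    | ()

  ~⇒∈N : ∀ {v u} → v ~ u → u ∈ N v
  ~⇒∈N {v} {u} v~u = lookup⇒[]= u _ (trans (lookup∘tabulate (λ w → does (v ~? w)) u) (dec-true (v ~? u) v~u))

  degree : Fin n → ℕ
  degree v = ∣ N v ∣

  minDegree : .{{_ : NonZero n}} → Minimum degree (λ _ → ⊤)
  minDegree = minimise (λ k → any? λ v → yes tt ×-dec (degree v ℕ.≟ k))
                       (fromℕ< (>-nonZero⁻¹ n) , tt)

  δ : .{{_ : NonZero n}} → ℕ
  δ = value minDegree

  NoIsolatedVertices : Set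
  NoIsolatedVertices = ∀ v → ∃[ u ] (v ~ u)

  Dominating : Subset n → Set
  Dominating S = ∀ v → v ∉ S → ∃[ u ] (u ∈ S × v ~ u)

  PerfectDominating : Subset n → Set
  PerfectDominating S = ∀ v → v ∉ S → ∃! _≡_ λ u → u ∈ S × v ~ u

  TotalDominating : Subset n → Set
  TotalDominating S = ∀ v → ∃[ u ] (u ∈ S × v ~ u)

  EfficientOpenDomination : Set
  EfficientOpenDomination = ∃[ D ]
    ((∀ v → ∃[ u ] (u ∈ D × v ∈ N u)) ×
     (∀ {u v} → u ∈ D → v ∈ D → u ≢ v → Empty (N u ∩ N v)))

  EfficientClosedDomination : Set
  EfficientClosedDomination = ∃[ S ]
    (Dominating S ×
     (∀ {u v} → u ∈ S → v ∈ S → u ≢ v → Empty (N[ u ] ∩ N[ v ])))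

  efficientOpen⇒noIsolated : EfficientOpenDomination → NoIsolatedVertices
  efficientOpen⇒noIsolated (D , cover , _) v with u , _ , v∈Nu ← cover v = u , sym~ (∈N⇒~ v∈Nu)

  PRDF : (Fin n → Fin 3) → Set
  PRDF f = ∀ u → f u ≡ 0F → ∃! _≡_ λ v → u ~ v × f v ≡ 2F

weight : (Fin n → Fin 3) → ℕ
weight f = sum (toℕ ∘ f)

private
  ∃!? : {P : Fin n → Set} → Decidable P → Dec (∃! _≡_ P)
  ∃!? P? = map′ (λ (x , px , u) → x , px , λ {y} → u y)
                (λ (x , px , u) → x , px , λ y → u {y})
                (any? λ x → P? x ×-dec all? λ y → P? y →-dec (x ≟ᶠ y))

module _ (G : Graph n) where
  open Graph G

  private
    dominating? : Decidable (Dominating G)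
    dominating? S = all? λ v → ¬? (v ∈? S) →-dec any? λ u → (u ∈? S) ×-dec (v ~? u)

    perfectDominating? : Decidable (PerfectDominating G)
    perfectDominating? S = all? λ v → ¬? (v ∈? S) →-dec ∃!? λ u → (u ∈? S) ×-dec (v ~? u)

    totalDominating? : Decidable (TotalDominating G)
    totalDominating? S = all? λ v → any? λ u → (u ∈? S) ×-dec (v ~? u)

    PRDF? : Decidable (PRDF G)
    PRDF? f = all? λ u → (f u ≟ᶠ 0F) →-dec ∃!? λ v → (u ~? v) ×-dec (f v ≟ᶠ 2F)

    PRDF-resp-≗ : ∀ {f g} → f ≗ g → PRDF G f → PRDF G g
    PRDF-resp-≗ f≗g p u gu≡0 with v , (u~v , fv≡2) , uniq ← p u (trans (f≗g u) gu≡0) =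
      v , (u~v , trans (sym (f≗g v)) fv≡2) , λ (u~w , gw≡2) → uniq (u~w , trans (f≗g _) gw≡2)

    attainedPRDF? : ∀ k → Dec (∃[ f ] (PRDF G f × weight f ≡ k))
    attainedPRDF? k = map′
      (λ (i , p , w) → finToFun i , p , w)
      (λ (f , p , w) → let eq = finToFun-funToFin f in
         funToFin f , PRDF-resp-≗ (sym ∘ eq) p , trans (sum-cong-≗ (cong toℕ ∘ eq)) w)
      (any? λ (i : Fin (3 ^ n)) → PRDF? (finToFun i) ×-dec (weight {n} (finToFun i) ℕ.≟ k))

  domination : Minimum ∣_∣ (Dominating G)
  domination = minimiseSubset dominating? (full , λ _ v∉ → contradiction ∈⊤ v∉)

  perfectDomination : Minimum ∣_∣ (PerfectDominating G)
  perfectDomination = minimiseSubset perfectDominating? (full , λ _ v∉ → contradiction ∈⊤ v∉)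

  totalDomination : NoIsolatedVertices G → Minimum ∣_∣ (TotalDominating G)
  totalDomination noIso = minimiseSubset totalDominating?
    (full , λ v → let u , v~u = noIso v in u , ∈⊤ , v~u)

  perfectRomanDomination : Minimum weight (PRDF G)
  perfectRomanDomination = minimise attainedPRDF? ((λ _ → 1F) , λ _ ())

  γ : ℕ
  γ = value domination

  γᵖ : ℕ
  γᵖ = value perfectDomination

  γₜ : NoIsolatedVertices G → ℕ
  γₜ noIso = value (totalDomination noIso)

  γᵖR : ℕ
  γᵖR = value perfectRomanDomination

module _ (G : Graph m) (H : Graph n) where
  private
    module G = Graph G
    module H = Graph H

  LexAdjacent : Rel (Fin m × Fin n) 0ℓ
  LexAdjacent (u , v) (x , y) = u G.~ x ⊎ (u ≡ x × v H.~ y)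

-- For graphs on m and n vertices, the vertex (u , v) of the product is
-- encoded as  combine u v : Fin (m * n), with inverse  remQuot n.
infixl 7 _⊚_
_⊚_ : Graph m → Graph n → Graph (m * n)
_⊚_ {m} {n} G H = record
  { _~_  = λ i j → LexAdjacent G H (remQuot {m} n i) (remQuot {m} n j)
  ; _~?_ = λ i j → adjacent? (remQuot {m} n i) (remQuot {m} n j)
  ; sym~ = symmetric
  ; irr~ = λ { refl (inj₁ p) → G.irr~ refl p ; refl (inj₂ (_ , q)) → H.irr~ refl q }
  }
  where
  module G = Graph G
  module H = Graph H
  adjacent? : Binary.Decidable (LexAdjacent G H)
  adjacent? (u , v) (x , y) = (u G.~? x) ⊎-dec ((u ≟ᶠ x) ×-dec (v H.~? y))
  symmetric : ∀ {p q} → LexAdjacent G H p q → LexAdjacent G H q p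
  symmetric (inj₁ p)       = inj₁ (G.sym~ p)
  symmetric (inj₂ (e , q)) = inj₂ (sym e , H.sym~ q)

𝒫₂ : Graph m → Graph n → Set
𝒫₂ G H = γ H ≡ 1 × EfficientClosedDomination G

-- γₜ is only defined in the absence of isolated vertices, which efficient open
-- domination provides.
𝒫₃ : Graph m → Graph n → .{{_ : NonTrivial n}} → Set
𝒫₃ {n = n} G H = δ H {{nonTrivial⇒nonZero n}} ≡ 0 ×
  Σ[ e ∈ EfficientOpenDomination G ] γᵖ G ≡ γₜ G (efficientOpen⇒noIsolated G e)

{-# OPTIONS --safe #-}

-- Collapsing every fibre {u} × V(H) of a PRDF of G ∘ H to 2 if it contains a 2,
-- to 0 if it vanishes and to 1 otherwise gives a PRDF of G, and the fibres of
-- weight at least 2 project to a dominating set of G; this is (i).  In the equality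
-- cases of (ii) and (iii) every fibre meeting f⁻¹(2) consists of a single 2 and
-- zeros, so the projection D of f⁻¹(2) is a perfect dominating set.  The zeros next
-- to a 2 at (u , h) are dominated exactly once, so u has at most one neighbour in D:
-- with none, h is universal in H; with one, h is isolated in H.  As H cannot have
-- both kinds of vertices, D is efficient closed or efficient open.  Conversely,
-- S × {h} with value 2 is a PRDF for efficient S and universal, respectively
-- isolated, h.  Sizes are compared through disjointness of the neighbourhoods of S,
-- which forces |S| to be γ(G), respectively γₜ(G).
module Submission where

open import Defs
open import Data.Bool using (true; false; if_then_else_)
open import Data.Fin using (Fin; zero; suc; toℕ; _↑ˡ_; _↑ʳ_; combine; remQuot; fromℕ<)
open import Data.Fin.Patterns using (0F; 1F; 2F)
open import Data.Fin.Properties using (any?; suc-injective; 0≢1+n; toℕ-injective; toℕ≤pred[n]; remQuot-combine;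
                                       combine-remQuot)
  renaming (_≟_ to _≟ᶠ_)
open import Data.Fin.Subset using (Subset; _∈_; _∉_; _∩_; ⁅_⁆; ∣_∣; _-_; Empty; inside; outside)
open import Data.Fin.Subset.Properties
  using (_∈?_; x∈⁅x⁆; x∈⁅y⁆⇒x≡y; x≢y⇒x∉⁅y⁆; ∣⁅x⁆∣≡1; Empty-unique; ∣⊥∣≡0;
         x∈p⇒∣p-x∣<∣p∣; x∈p∧x≢y⇒x∈p-y; x∈p∩q⁺; x∈p∩q⁻; x∈p∪q⁺; x∈p∪q⁻)
open import Data.Nat using (ℕ; zero; suc; _+_; _*_; _≤_; _<_; _≥_; _≤?_; _⊔_; z≤n; s≤s; NonZero; NonTrivial;
                            nonTrivial⇒n>1; nonTrivial⇒nonZero)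
open import Data.Nat.Properties
  using (+-0-commutativeMonoid; +-assoc; +-mono-≤; +-monoˡ-≤; +-monoʳ-≤; +-cancelʳ-≤; +-cancelˡ-≤; *-suc;
         *-monoʳ-≤; *-cancelˡ-≤; ≤-reflexive; ≤-trans; ≤-antisym; <-≤-trans; ≤-<-trans; <⇒≱;
         ≰⇒>; m≤m+n; m≤n+m; n≤0⇒n≡0; n≢0⇒n>0; ⊔-lub; _≟_; module ≤-Reasoning)
open import Algebra.Properties.CommutativeMonoid.Sum +-0-commutativeMonoid
  using (sum; sum-replicate-zero) renaming (sum-cong-≗ to sum-cong)
open import Data.Product using (∃; ∃-syntax; ∃!; _×_; _,_; proj₁; proj₂; uncurry)
open import Data.Sum using (_⊎_; inj₁; inj₂)
open import Data.Unit using (tt)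
open import Data.Vec using ([]; _∷_; here; there; tabulate)
open import Data.Vec.Properties using (lookup⇒[]=; []=⇒lookup; lookup∘tabulate)
open import Function using (_∘_)
open import Function.Bundles using (_⇔_; mk⇔)
open import Relation.Binary.PropositionalEquality
  using (_≡_; _≢_; refl; sym; trans; cong; cong₂; subst; subst₂)
open import Relation.Nullary using (¬_; yes; no; does; contradiction)
open import Relation.Nullary.Decidable using (dec-true; dec-false; ¬?; _×-dec_)
open import Relation.Unary using (Decidable)

private
  variable
    m n : ℕ

-- Finite sums and their equality cases.

sum-mono-≤ : (f g : Fin n → ℕ) → (∀ i → f i ≤ g i) → sum f ≤ sum g
sum-mono-≤ {zero}  f g f≤g = z≤n
sum-mono-≤ {suc n} f g f≤g = +-mono-≤ (f≤g zero) (sum-mono-≤ (f ∘ suc) (g ∘ suc) (f≤g ∘ suc))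

-- A strict inequality at one index could not be compensated at the others. Every equality case
-- below is reduced to this squeeze.
sum-≤-≥⇒≗ : (f g : Fin n → ℕ) → (∀ i → f i ≤ g i) → sum g ≤ sum f → ∀ i → f i ≡ g i
sum-≤-≥⇒≗ {suc n} f g f≤g Σg≤Σf = λ where
    zero    → ≤-antisym (f≤g zero) (+-cancelʳ-≤ (sum (g ∘ suc)) _ _
                (≤-trans Σg≤Σf (+-monoʳ-≤ (f zero) tail≤)))
    (suc i) → sum-≤-≥⇒≗ (f ∘ suc) (g ∘ suc) (f≤g ∘ suc)
                (+-cancelˡ-≤ (g zero) _ _ (≤-trans Σg≤Σf (+-monoˡ-≤ _ (f≤g zero)))) i
  where
  tail≤ : sum (f ∘ suc) ≤ sum (g ∘ suc)
  tail≤ = sum-mono-≤ (f ∘ suc) (g ∘ suc) (f≤g ∘ suc)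

term≤sum : (f : Fin n → ℕ) → ∀ i → f i ≤ sum f
term≤sum f zero    = m≤m+n _ _
term≤sum f (suc i) = ≤-trans (term≤sum (f ∘ suc) i) (m≤n+m _ _)

sum-++ : ∀ m {n} (f : Fin (m + n) → ℕ) → sum f ≡ sum (f ∘ (_↑ˡ n)) + sum (f ∘ (m ↑ʳ_))
sum-++ zero    f = refl
sum-++ (suc m) f = trans (cong (f zero +_) (sum-++ m (f ∘ suc))) (sym (+-assoc (f zero) _ _))

sum-combine : ∀ m {n} (f : Fin (m * n) → ℕ) → sum f ≡ sum λ u → sum {n} λ v → f (combine {m} u v)
sum-combine zero        f = refl
sum-combine (suc m) {n} f = trans (sum-++ n f) (cong (sum (f ∘ (_↑ˡ m * n)) +_) (sum-combine m (f ∘ (n ↑ʳ_))))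

-- Cardinalities of subsets.

-- A pigeonhole for relations: the partner `t₀` of the first element is deleted from `T`, and by
-- injectivity no later element had `t₀` as its partner.
∣∣-≤-injection : (S : Subset m) (T : Subset n) (R : Fin m → Fin n → Set) →
                 (∀ {u} → u ∈ S → ∃[ t ] (t ∈ T × R u t)) →
                 (∀ {u v t} → u ∈ S → v ∈ S → R u t → R v t → u ≡ v) → ∣ S ∣ ≤ ∣ T ∣
∣∣-≤-injection []            T R total inj = z≤n
∣∣-≤-injection (outside ∷ S) T R total inj =
  ∣∣-≤-injection S T (R ∘ suc) (total ∘ there)
    λ u∈ v∈ r s → suc-injective (inj (there u∈) (there v∈) r s)
∣∣-≤-injection (inside ∷ S) T R total inj with t₀ , t₀∈T , r₀ ← total here =
  ≤-<-trans
    (∣∣-≤-injection S (T - t₀) (R ∘ suc)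
      (λ u∈ → let t , t∈T , r = total (there u∈) in
        t , x∈p∧x≢y⇒x∈p-y t∈T (λ { refl → 0≢1+n (sym (inj (there u∈) here r r₀)) }) , r)
      λ u∈ v∈ r s → suc-injective (inj (there u∈) (there v∈) r s))
    (x∈p⇒∣p-x∣<∣p∣ t₀∈T)

x∈p⇒∣p∣>0 : {p : Subset n} {x : Fin n} → x ∈ p → 0 < ∣ p ∣
x∈p⇒∣p∣>0 x∈p = ≤-<-trans z≤n (x∈p⇒∣p-x∣<∣p∣ x∈p)

∣p∣≤1⇒unique : {p : Subset n} {x y : Fin n} → ∣ p ∣ ≤ 1 → x ∈ p → y ∈ p → x ≡ y
∣p∣≤1⇒unique {x = x} {y} ∣p∣≤1 x∈p y∈p with x ≟ᶠ y
... | yes x≡y = x≡y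
... | no x≢y  = contradiction ∣p∣≤1
  (<⇒≱ (≤-<-trans (x∈p⇒∣p∣>0 (x∈p∧x≢y⇒x∈p-y x∈p x≢y)) (x∈p⇒∣p-x∣<∣p∣ y∈p)))

module _ {P : Fin n → Set} (P? : Decidable P) where

  subset : Subset n
  subset = tabulate (does ∘ P?)

  ∈-subset⁺ : ∀ {v} → P v → v ∈ subset
  ∈-subset⁺ {v} pv = lookup⇒[]= v _ (trans (lookup∘tabulate (does ∘ P?) v) (dec-true (P? v) pv))

  ∈-subset⁻ : ∀ {v} → v ∈ subset → P v
  ∈-subset⁻ {v} v∈ with P? v | trans (sym (lookup∘tabulate (does ∘ P?) v)) ([]=⇒lookup v∈)
  ... | yes pv | _ = pv
  ... | no _   | ()

element : 1 < n → Fin n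
element 1<n = fromℕ< (≤-trans (s≤s z≤n) 1<n)

another : 1 < n → (v : Fin n) → ∃[ w ] w ≢ v
another {suc (suc n)} _ zero    = suc zero , λ ()
another {suc (suc n)} _ (suc v) = zero , λ ()
another {suc zero} (s≤s ())

-- Functions with value 2 on a set and 0 elsewhere, and bounds on weights.

romanOn : Subset n → Fin n → Fin 3
romanOn S v = if does (v ∈? S) then 2F else 0F

romanOn-∈ : {S : Subset n} {v : Fin n} → v ∈ S → romanOn S v ≡ 2F
romanOn-∈ {S = S} {v} v∈S rewrite dec-true (v ∈? S) v∈S = refl

romanOn-∉ : {S : Subset n} {v : Fin n} → v ∉ S → romanOn S v ≡ 0F
romanOn-∉ {S = S} {v} v∉S rewrite dec-false (v ∈? S) v∉S = refl

romanOn≡2⇒∈ : {S : Subset n} {v : Fin n} → romanOn S v ≡ 2F → v ∈ S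
romanOn≡2⇒∈ {S = S} {v} eq with v ∈? S
... | yes v∈S = v∈S
romanOn≡2⇒∈ () | no _

romanOn≡0⇒∉ : {S : Subset n} {v : Fin n} → romanOn S v ≡ 0F → v ∉ S
romanOn≡0⇒∉ eq v∈S with trans (sym (romanOn-∈ v∈S)) eq
... | ()

weight-romanOn : (S : Subset n) → weight (romanOn S) ≡ 2 * ∣ S ∣
weight-romanOn []            = refl
weight-romanOn (outside ∷ S) = weight-romanOn S
weight-romanOn (inside ∷ S)  = trans (cong (2 +_) (weight-romanOn S)) (sym (*-suc 2 ∣ S ∣))

romanOn-≤ : (S : Subset n) (w : Fin n → ℕ) → (∀ {v} → v ∈ S → 2 ≤ w v) → ∀ v → toℕ (romanOn S v) ≤ w v
romanOn-≤ S w 2≤w v with v ∈? S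
... | yes v∈S = 2≤w v∈S
... | no _    = z≤n

2*∣S∣≤sum : (S : Subset n) (w : Fin n → ℕ) → (∀ {v} → v ∈ S → 2 ≤ w v) → 2 * ∣ S ∣ ≤ sum w
2*∣S∣≤sum S w 2≤w =
  subst (_≤ sum w) (weight-romanOn S) (sum-mono-≤ _ w (romanOn-≤ S w 2≤w))

sum≤2*∣S∣⇒≗ : (S : Subset n) (w : Fin n → ℕ) → (∀ {v} → v ∈ S → 2 ≤ w v) → sum w ≤ 2 * ∣ S ∣ →
              ∀ v → toℕ (romanOn S v) ≡ w v
sum≤2*∣S∣⇒≗ S w 2≤w Σ≤ =
  sum-≤-≥⇒≗ _ w (romanOn-≤ S w 2≤w) (subst (sum w ≤_) (sym (weight-romanOn S)) Σ≤)

module _ (a : Fin n → Fin 3) where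

  two⇒2≤weight : ∀ {v} → a v ≡ 2F → 2 ≤ weight a
  two⇒2≤weight {v} av≡2 = subst (λ x → toℕ x ≤ weight a) av≡2 (term≤sum (toℕ ∘ a) v)

  weight≡0⇒zero : weight a ≡ 0 → ∀ v → a v ≡ 0F
  weight≡0⇒zero w≡0 v = toℕ-injective (n≤0⇒n≡0 (subst (toℕ (a v) ≤_) w≡0 (term≤sum (toℕ ∘ a) v)))

  -- The 2 at `h` exhausts the weight: the squeeze against `romanOn ⁅ h ⁆` leaves 0 elsewhere.
  single-two : weight a ≤ 2 → ∀ {h v} → a h ≡ 2F → v ≢ h → a v ≡ 0F
  single-two w≤2 {h} {v} ah≡2 v≢h = toℕ-injective (trans
    (sym (sum≤2*∣S∣⇒≗ ⁅ h ⁆ (toℕ ∘ a)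
      (λ u∈ → ≤-reflexive (cong toℕ (sym (trans (cong a (x∈⁅y⁆⇒x≡y h u∈)) ah≡2))))
      (subst (λ k → weight a ≤ 2 * k) (sym (∣⁅x⁆∣≡1 h)) w≤2) v))
    (cong toℕ (romanOn-∉ (x≢y⇒x∉⁅y⁆ v≢h))))

no-zero⇒n≤weight : (a : Fin n → Fin 3) → (∀ v → a v ≢ 0F) → n ≤ weight a
no-zero⇒n≤weight {zero}  a nz = z≤n
no-zero⇒n≤weight {suc n} a nz =
  +-mono-≤ (n≢0⇒n>0 (nz zero ∘ toℕ-injective)) (no-zero⇒n≤weight (a ∘ suc) (nz ∘ suc))

weight<n⇒zero : (a : Fin n → Fin 3) → weight a < n → ∃[ v ] a v ≡ 0F
weight<n⇒zero a w<n with any? (λ v → a v ≟ᶠ 0F)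
... | yes zero-at = zero-at
... | no ∄zero    = contradiction (no-zero⇒n≤weight a λ v av≡0 → ∄zero (v , av≡0)) (<⇒≱ w<n)

disjoint⇒≡ : ∀ {S : Subset n} {B : Fin n → Subset n} →
             (∀ {u v} → u ∈ S → v ∈ S → u ≢ v → Empty (B u ∩ B v)) →
             ∀ {u v w} → u ∈ S → v ∈ S → w ∈ B u → w ∈ B v → u ≡ v
disjoint⇒≡ disj {u} {v} u∈S v∈S w∈Bu w∈Bv with u ≟ᶠ v
... | yes u≡v = u≡v
... | no u≢v  = contradiction (_ , x∈p∩q⁺ (w∈Bu , w∈Bv)) (disj u∈S v∈S u≢v)

-- Domination parameters, efficient sets, universal and isolated vertices of one graph.

module _ (G : Graph n) where
  open Graph G

  IsEfficientOpen : Subset n → Set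
  IsEfficientOpen D = (∀ v → ∃[ u ] (u ∈ D × v ∈ N G u)) ×
                      (∀ {u v} → u ∈ D → v ∈ D → u ≢ v → Empty (N G u ∩ N G v))

  IsEfficientClosed : Subset n → Set
  IsEfficientClosed S = Dominating G S ×
                        (∀ {u v} → u ∈ S → v ∈ S → u ≢ v → Empty (N[_] G u ∩ N[_] G v))

  ∈N[]⁺ : ∀ {v u} → v ~ u ⊎ u ≡ v → u ∈ N[_] G v
  ∈N[]⁺ (inj₁ v~u)  = x∈p∪q⁺ (inj₁ (~⇒∈N G v~u))
  ∈N[]⁺ (inj₂ refl) = x∈p∪q⁺ (inj₂ (x∈⁅x⁆ _))

  ∈N[]⁻ : ∀ {v u} → u ∈ N[_] G v → v ~ u ⊎ u ≡ v
  ∈N[]⁻ {v} u∈ with x∈p∪q⁻ (N G v) ⁅ v ⁆ u∈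
  ... | inj₁ u∈N = inj₁ (∈N⇒~ G u∈N)
  ... | inj₂ u∈v = inj₂ (x∈⁅y⁆⇒x≡y v u∈v)

  perfect⇒dominating : ∀ {S} → PerfectDominating G S → Dominating G S
  perfect⇒dominating perf v v∉S = let u , u∈S~v , _ = perf v v∉S in u , u∈S~v

  γ≤ : ∀ {S} → Dominating G S → γ G ≤ ∣ S ∣
  γ≤ = Minimum.minimal (domination G)

  γᵖ≤ : ∀ {S} → PerfectDominating G S → γᵖ G ≤ ∣ S ∣
  γᵖ≤ = Minimum.minimal (perfectDomination G)

  γᵖR≤ : ∀ {f} → PRDF G f → γᵖR G ≤ weight f
  γᵖR≤ = Minimum.minimal (perfectRomanDomination G)

  γ≤γᵖ : γ G ≤ γᵖ G
  γ≤γᵖ with S , perf , ∣S∣≡ ← Minimum.attained (perfectDomination G) =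
    subst (γ G ≤_) ∣S∣≡ (γ≤ (perfect⇒dominating perf))

  γᵖR≤2γᵖ : γᵖR G ≤ 2 * γᵖ G
  γᵖR≤2γᵖ with S , perf , ∣S∣≡ ← Minimum.attained (perfectDomination G) =
    subst (γᵖR G ≤_) (trans (weight-romanOn S) (cong (2 *_) ∣S∣≡)) (γᵖR≤ prdf)
    where
    prdf : PRDF G (romanOn S)
    prdf v v≡0 with u , (u∈S , v~u) , uniq ← perf v (romanOn≡0⇒∉ v≡0) =
      u , (v~u , romanOn-∈ u∈S) , λ (v~w , w≡2) → uniq (romanOn≡2⇒∈ w≡2 , v~w)

  -- A minimum dominating set `T` meets every closed neighbourhood, and the closed neighbourhoods of
  -- the vertices of `S` are disjoint, so they use up distinct vertices of `T`.
  efficientClosed⇒∣S∣≤γ : ∀ {S} → IsEfficientClosed S → ∣ S ∣ ≤ γ G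
  efficientClosed⇒∣S∣≤γ {S} (_ , disj) with T , dom , ∣T∣≡ ← Minimum.attained (domination G) =
    subst (∣ S ∣ ≤_) ∣T∣≡ (∣∣-≤-injection S T (λ u t → t ∈ N[_] G u) (λ {u} _ → meets u) (disjoint⇒≡ disj))
    where
    meets : ∀ u → ∃[ t ] (t ∈ T × t ∈ N[_] G u)
    meets u with u ∈? T
    ... | yes u∈T = u , u∈T , ∈N[]⁺ (inj₂ refl)
    ... | no u∉T  = let t , t∈T , u~t = dom u u∉T in t , t∈T , ∈N[]⁺ (inj₁ u~t)

  -- The cover makes `D` total dominating. Conversely, a total dominating set meets the disjoint
  -- open neighbourhoods of the vertices of `D` in distinct vertices.
  efficientOpen⇒γₜ≡∣D∣ : ∀ {D} → IsEfficientOpen D → (noIso : NoIsolatedVertices G) → γₜ G noIso ≡ ∣ D ∣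
  efficientOpen⇒γₜ≡∣D∣ {D} (cover , disj) noIso
    with T , total , ∣T∣≡ ← Minimum.attained (totalDomination G noIso) = ≤-antisym
      (Minimum.minimal (totalDomination G noIso)
        λ v → let u , u∈D , v∈Nu = cover v in u , u∈D , sym~ (∈N⇒~ G v∈Nu))
      (subst (∣ D ∣ ≤_) ∣T∣≡ (∣∣-≤-injection D T (λ u t → t ∈ N G u)
        (λ {u} _ → let t , t∈T , u~t = total u in t , t∈T , ~⇒∈N G u~t) (disjoint⇒≡ disj)))

  Universal : Fin n → Set
  Universal h = ∀ v → v ≢ h → v ~ h

  Isolated : Fin n → Set
  Isolated h = ∀ v → ¬ (v ~ h)

  -- This keeps the closed and the open case of `efficient` from mixing.
  universal⇒¬isolated : 1 < n → ∀ {h k} → Universal h → ¬ Isolated k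
  universal⇒¬isolated 1<n {h} {k} univ isol with k ≟ᶠ h
  ... | yes refl = let v , v≢k = another 1<n k in isol v (univ v v≢k)
  ... | no k≢h   = isol h (sym~ (univ k k≢h))

  universal⇒γ≡1 : ∀ {h} → Universal h → γ G ≡ 1
  universal⇒γ≡1 {h} univ = ≤-antisym
    (subst (γ G ≤_) (∣⁅x⁆∣≡1 h) (γ≤ λ v v∉ → h , x∈⁅x⁆ h , univ v λ { refl → v∉ (x∈⁅x⁆ h) }))
    0<γ
    where
    0<γ : 0 < γ G
    0<γ with S , dom , ∣S∣≡ ← Minimum.attained (domination G) with h ∈? S
    ... | yes h∈S = subst (0 <_) ∣S∣≡ (x∈p⇒∣p∣>0 h∈S)
    ... | no h∉S  = let u , u∈S , _ = dom h h∉S in subst (0 <_) ∣S∣≡ (x∈p⇒∣p∣>0 u∈S)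

  γ≡1⇒universal : Fin n → γ G ≡ 1 → ∃ Universal
  γ≡1⇒universal v₀ γ≡1 with S , dom , ∣S∣≡ ← Minimum.attained (domination G) =
    h , λ v v≢h → let u , u∈S , v~u = dom v (v≢h ∘ only-h) in subst (v ~_) (only-h u∈S) v~u
    where
    member : ∃[ h ] h ∈ S
    member with v₀ ∈? S
    ... | yes v₀∈S = v₀ , v₀∈S
    ... | no v₀∉S  = let u , u∈S , _ = dom v₀ v₀∉S in u , u∈S
    h : Fin n
    h = proj₁ member
    only-h : ∀ {v} → v ∈ S → v ≡ h
    only-h v∈S = ∣p∣≤1⇒unique (≤-reflexive (trans ∣S∣≡ γ≡1)) v∈S (proj₂ member)

  isolated⇒δ≡0 : .{{_ : NonZero n}} → ∀ {h} → Isolated h → δ G ≡ 0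
  isolated⇒δ≡0 {h} isol = n≤0⇒n≡0 (≤-trans (Minimum.minimal (minDegree G) tt) (≤-reflexive degree≡0))
    where
    degree≡0 : degree G h ≡ 0
    degree≡0 = trans (cong ∣_∣ (Empty-unique λ (v , v∈N) → isol v (sym~ (∈N⇒~ G v∈N)))) (∣⊥∣≡0 n)

  δ≡0⇒isolated : .{{_ : NonZero n}} → δ G ≡ 0 → ∃ Isolated
  δ≡0⇒isolated δ≡0 with h , _ , deg≡ ← Minimum.attained (minDegree G) =
    h , λ v v~h → contradiction (x∈p⇒∣p∣>0 (~⇒∈N G (sym~ v~h))) (<⇒≱ (s≤s (≤-reflexive (trans deg≡ δ≡0))))

-- Fibres of functions on the product, and functions supported on one layer.

fibre : ∀ m {n} → (Fin (m * n) → Fin 3) → Fin m → Fin n → Fin 3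
fibre m f u v = f (combine u v)

fibreWeight : ∀ m {n} → (Fin (m * n) → Fin 3) → Fin m → ℕ
fibreWeight m {n} f u = weight (fibre m {n} f u)

weight-fibres : ∀ m {n} (f : Fin (m * n) → Fin 3) → weight f ≡ sum (fibreWeight m {n} f)
weight-fibres m f = sum-combine m (toℕ ∘ f)

module _ (S : Subset m) (h : Fin n) where

  spread : Fin (m * n) → Fin 3
  spread i = let u , v = remQuot n i in if does (u ∈? S) then romanOn ⁅ h ⁆ v else 0F

  weight-spread : weight spread ≡ 2 * ∣ S ∣
  weight-spread = trans (weight-fibres m spread) (trans (sum-cong fibre-weight) (weight-romanOn S))
    where
    fibre-weight : ∀ u → fibreWeight m spread u ≡ toℕ (romanOn S u)
    fibre-weight u = trans (sum-cong λ v →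
      cong (λ (u , v) → toℕ (if does (u ∈? S) then romanOn ⁅ h ⁆ v else 0F)) (remQuot-combine u v)) scaled
      where
      scaled : sum (λ v → toℕ (if does (u ∈? S) then romanOn ⁅ h ⁆ v else 0F)) ≡ toℕ (romanOn S u)
      scaled with does (u ∈? S)
      ... | true  = trans (weight-romanOn ⁅ h ⁆) (cong (2 *_) (∣⁅x⁆∣≡1 h))
      ... | false = sum-replicate-zero n

  spread≡2 : ∀ i → spread i ≡ 2F → proj₁ (remQuot {m} n i) ∈ S × proj₂ (remQuot {m} n i) ≡ h
  spread≡2 i eq with proj₁ (remQuot {m} n i) ∈? S
  ... | yes u∈S = u∈S , x∈⁅y⁆⇒x≡y h (romanOn≡2⇒∈ eq)
  spread≡2 i () | no _

  spread-∈ : ∀ i → proj₁ (remQuot {m} n i) ∈ S → proj₂ (remQuot {m} n i) ≡ h → spread i ≡ 2F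
  spread-∈ i u∈S v≡h rewrite dec-true (proj₁ (remQuot {m} n i) ∈? S) u∈S =
    romanOn-∈ {v = proj₂ (remQuot {m} n i)} (subst (_∈ ⁅ h ⁆) (sym v≡h) (x∈⁅x⁆ h))

  spread-combine : ∀ {u} → u ∈ S → spread (combine u h) ≡ 2F
  spread-combine {u} u∈S =
    spread-∈ (combine u h) (subst (λ p → proj₁ p ∈ S) (sym (remQuot-combine u h)) u∈S)
             (cong proj₂ (remQuot-combine u h))

module _ (G : Graph m) (H : Graph n) where
  private
    module G = Graph G
    module H = Graph H

  -- PRDFs of the product built from efficient sets.

  -- All 2s have second coordinate `h`, so a dominator is determined by its first coordinate. The
  -- premise `u ∈ S → v ≢ h` says that `(u , v)` lies off the support.
  PRDF-spread : ∀ {S h} →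
    (∀ u v → (u ∈ S → v ≢ h) → ∃! _≡_ λ x → x ∈ S × LexAdjacent G H (u , v) (x , h)) →
    PRDF (G ⊚ H) (spread S h)
  PRDF-spread {S} {h} unique i i≡0
    with x , (x∈S , adj) , uniq ← unique (proj₁ (remQuot {m} n i)) (proj₂ (remQuot {m} n i))
           (λ u∈S v≡h → contradiction (trans (sym i≡0) (spread-∈ S h i u∈S v≡h)) λ ())
    = combine x h
    , (subst (LexAdjacent G H (remQuot {m} n i)) (sym (remQuot-combine x h)) adj , spread-combine S h x∈S)
    , λ {j} (adj′ , j≡2) → let x′∈S , y≡h = spread≡2 S h j j≡2 in
        trans (cong₂ combine (uniq (x′∈S ,
                subst (λ y → LexAdjacent G H (remQuot {m} n i) (proj₁ (remQuot {m} n j) , y)) y≡h adj′))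
              (sym y≡h))
              (combine-remQuot {m} n j)

  -- A vertex over `S` is dominated inside its own fibre because `h` is universal, any other through
  -- `G`. In both cases `u` lies in the closed neighbourhood of the dominator, and disjointness
  -- gives uniqueness.
  PRDF-spread-closed : ∀ {S h} → IsEfficientClosed G S → Universal H h → PRDF (G ⊚ H) (spread S h)
  PRDF-spread-closed {S} {h} (dom , disj) univ = PRDF-spread λ u v v≢h →
    let x , x∈S , adj = dominator u v v≢h in
    x , (x∈S , adj) , λ (y∈S , adj′) → disjoint⇒≡ disj x∈S y∈S (closed adj) (closed adj′)
    where
    closed : ∀ {u v x} → LexAdjacent G H (u , v) (x , h) → u ∈ N[_] G x
    closed (inj₁ u~x)       = ∈N[]⁺ G (inj₁ (G.sym~ u~x))
    closed (inj₂ (u≡x , _)) = ∈N[]⁺ G (inj₂ u≡x)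
    dominator : ∀ u v → (u ∈ S → v ≢ h) → ∃[ x ] (x ∈ S × LexAdjacent G H (u , v) (x , h))
    dominator u v v≢h with u ∈? S
    ... | yes u∈S = u , u∈S , inj₂ (refl , univ v (v≢h u∈S))
    ... | no u∉S  = let x , x∈S , u~x = dom u u∉S in x , x∈S , inj₁ u~x

  -- As `h` is isolated, no domination happens inside a fibre, so the dominators of `(u , v)`
  -- correspond to the unique `x ∈ D` with `u ∈ N G x`.
  PRDF-spread-open : ∀ {D h} → IsEfficientOpen G D → Isolated H h → PRDF (G ⊚ H) (spread D h)
  PRDF-spread-open {D} {h} (cover , disj) isol = PRDF-spread λ u v _ →
    let x , x∈D , u∈Nx = cover u in
    x , (x∈D , inj₁ (G.sym~ (∈N⇒~ G u∈Nx))) ,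
    λ (y∈D , adj) → disjoint⇒≡ disj x∈D y∈D u∈Nx (open-adj adj)
    where
    open-adj : ∀ {u v x} → LexAdjacent G H (u , v) (x , h) → u ∈ N G x
    open-adj (inj₁ u~x)       = ~⇒∈N G (G.sym~ u~x)
    open-adj (inj₂ (_ , v~h)) = contradiction v~h (isol _)

  -- The bound is in terms of `γᵖ` so that it serves both converses: one turns `2 * γᵖ G` into
  -- `γᵖR G`, the other into `2 * γ G`.
  𝒫⇒γᵖR≤2γᵖ : .{{_ : NonTrivial n}} → 𝒫₂ G H ⊎ 𝒫₃ G H → γᵖR (G ⊚ H) ≤ 2 * γᵖ G
  𝒫⇒γᵖR≤2γᵖ (inj₁ (γH≡1 , S , eff))
    with h , univ ← γ≡1⇒universal H (element (nonTrivial⇒n>1 n)) γH≡1 = begin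
      γᵖR (G ⊚ H)         ≤⟨ γᵖR≤ (G ⊚ H) (PRDF-spread-closed eff univ) ⟩
      weight (spread S h) ≡⟨ weight-spread S h ⟩
      2 * ∣ S ∣           ≤⟨ *-monoʳ-≤ 2 (≤-trans (efficientClosed⇒∣S∣≤γ G eff) (γ≤γᵖ G)) ⟩
      2 * γᵖ G            ∎
    where open ≤-Reasoning
  𝒫⇒γᵖR≤2γᵖ (inj₂ (δ≡0 , (D , eff) , γᵖ≡γₜ))
    with h , isol ← δ≡0⇒isolated H {{nonTrivial⇒nonZero n}} δ≡0 = begin
      γᵖR (G ⊚ H)         ≤⟨ γᵖR≤ (G ⊚ H) (PRDF-spread-open eff isol) ⟩
      weight (spread D h) ≡⟨ weight-spread D h ⟩
      2 * ∣ D ∣           ≡⟨ cong (2 *_) (sym (trans γᵖ≡γₜ (efficientOpen⇒γₜ≡∣D∣ G eff _))) ⟩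
      2 * γᵖ G            ∎
    where open ≤-Reasoning

  -- Projecting a PRDF of the product to the first factor.

  module _ (1<n : 1 < n) (f : Fin (m * n) → Fin 3) (prdf : PRDF (G ⊚ H) f) where
    private
      a : Fin m → Fin n → Fin 3
      a = fibre m f

      W : Fin m → ℕ
      W = fibreWeight m f

      HasTwo : Fin m → Set
      HasTwo u = ∃[ v ] a u v ≡ 2F

      hasTwo? : Decidable HasTwo
      hasTwo? u = any? λ v → a u v ≟ᶠ 2F

      zero-dominated : ∀ u v → a u v ≡ 0F →
                       ∃! _≡_ λ p → LexAdjacent G H (u , v) p × uncurry a p ≡ 2F
      zero-dominated u v uv≡0 with j , (adj , j≡2) , uniq ← prdf (combine u v) uv≡0 =
        remQuot {m} n j ,
        (subst (λ p → LexAdjacent G H p (remQuot {m} n j)) (remQuot-combine u v) adj ,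
         trans (cong f (combine-remQuot {m} n j)) j≡2) ,
        λ { {x , y} (adj′ , xy≡2) → trans
          (cong (remQuot {m} n)
            (uniq (subst₂ (LexAdjacent G H) (sym (remQuot-combine u v)) (sym (remQuot-combine x y)) adj′ , xy≡2)))
          (remQuot-combine x y) }

      -- Uniqueness is kept only for the fibre of the dominator, which is what matters for sets in
      -- `G`.
      zero-dominated! : ∀ {u v} → a u v ≡ 0F → ∀ {x y x′ y′} →
                        LexAdjacent G H (u , v) (x , y) → a x y ≡ 2F →
                        LexAdjacent G H (u , v) (x′ , y′) → a x′ y′ ≡ 2F → x ≡ x′
      zero-dominated! {u} {v} uv≡0 adj xy≡2 adj′ xy≡2′ =
        let _ , _ , uniq = zero-dominated u v uv≡0 in
        cong proj₁ (trans (sym (uniq (adj , xy≡2))) (uniq (adj′ , xy≡2′)))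

      -- Without a 2 in the fibre of `u`, the dominator of the zero lies in a different fibre.
      -- Adjacent fibres are completely joined, so a second neighbouring fibre with a 2 would
      -- dominate the same zero again.
      neighbour-fibre : ∀ {u v} → ¬ HasTwo u → a u v ≡ 0F → ∃! _≡_ λ x → HasTwo x × u G.~ x
      neighbour-fibre {u} {v} ¬two uv≡0 with zero-dominated u v uv≡0
      ... | (x , y) , (inj₁ u~x , xy≡2) , _ =
        x , ((y , xy≡2) , u~x) ,
        λ ((y′ , xy≡2′) , u~x′) → zero-dominated! uv≡0 (inj₁ u~x) xy≡2 (inj₁ u~x′) xy≡2′
      ... | (x , y) , (inj₂ (refl , _) , xy≡2) , _ = contradiction (y , xy≡2) ¬two

      collapse : Fin m → Fin 3
      collapse u with hasTwo? u | W u ≟ 0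
      ... | yes _ | _     = 2F
      ... | no _  | yes _ = 0F
      ... | no _  | no _  = 1F

      collapse-two : ∀ {u} → HasTwo u → collapse u ≡ 2F
      collapse-two {u} two with hasTwo? u | W u ≟ 0
      ... | yes _   | _ = refl
      ... | no ¬two | _ = contradiction two ¬two

      collapse≡2 : ∀ {u} → collapse u ≡ 2F → HasTwo u
      collapse≡2 {u} eq with hasTwo? u | W u ≟ 0
      ... | yes two | _ = two
      collapse≡2 () | no _ | yes _
      collapse≡2 () | no _ | no _

      collapse≡0 : ∀ {u} → collapse u ≡ 0F → ¬ HasTwo u × W u ≡ 0
      collapse≡0 {u} eq with hasTwo? u | W u ≟ 0
      collapse≡0 () | yes _ | _
      ... | no ¬two | yes W≡0 = ¬two , W≡0
      collapse≡0 () | no _ | no _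

      collapse≤1 : ∀ {u} → ¬ HasTwo u → toℕ (collapse u) ≤ 1
      collapse≤1 {u} ¬two with hasTwo? u | W u ≟ 0
      ... | yes two | _   = contradiction two ¬two
      ... | no _ | yes _  = z≤n
      ... | no _ | no _   = s≤s z≤n

      collapse≤W : ∀ u → toℕ (collapse u) ≤ W u
      collapse≤W u with hasTwo? u | W u ≟ 0
      ... | yes (v , uv≡2) | _ = two⇒2≤weight (a u) uv≡2
      ... | no _ | yes _ = z≤n
      ... | no _ | no W≢0 = n≢0⇒n>0 W≢0

      collapse-PRDF : PRDF G collapse
      collapse-PRDF u u≡0 with ¬two , W≡0 ← collapse≡0 u≡0
        -- The whole fibre vanishes, so any vertex of `H` supplies the zero.
        with x , (two , u~x) , uniq ← neighbour-fibre ¬two (weight≡0⇒zero (a u) W≡0 (element 1<n)) =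
        x , (u~x , collapse-two two) , λ (u~y , y≡2) → uniq (collapse≡2 y≡2 , u~y)

      D : Subset m
      D = subset hasTwo?

      D⇒2≤W : ∀ {u} → u ∈ D → 2 ≤ W u
      D⇒2≤W {u} u∈D = two⇒2≤weight (a u) (proj₂ (∈-subset⁻ hasTwo? u∈D))

      zeros⇒perfectDominating : (∀ u → ¬ HasTwo u → ∃[ v ] a u v ≡ 0F) → PerfectDominating G D
      zeros⇒perfectDominating zeros u u∉D
        with ¬two ← u∉D ∘ ∈-subset⁺ hasTwo?
        with x , (two , u~x) , uniq ← neighbour-fibre ¬two (proj₂ (zeros u ¬two)) =
        x , (∈-subset⁺ hasTwo? two , u~x) , λ (y∈D , u~y) → uniq (∈-subset⁻ hasTwo? y∈D , u~y)

      2≤W? : Decidable (λ u → 2 ≤ W u)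
      2≤W? u = 2 ≤? W u

      heavy : Subset m
      heavy = subset 2≤W?

      -- A fibre of weight below 2 contains no 2, and it contains a zero since `n` is at least 2;
      -- the fibre dominating this zero has a 2 and is heavy.
      heavy-dominating : Dominating G heavy
      heavy-dominating u u∉ =
        let W<2 = ≰⇒> (u∉ ∘ ∈-subset⁺ 2≤W?)
            v , uv≡0 = weight<n⇒zero (a u) (<-≤-trans W<2 1<n)
            x , ((y , xy≡2) , u~x) , _ =
              neighbour-fibre (λ (v , uv≡2) → <⇒≱ W<2 (two⇒2≤weight (a u) uv≡2)) uv≡0
        in x , ∈-subset⁺ 2≤W? (two⇒2≤weight (a x) xy≡2) , u~x

      -- Structure of a PRDF whose fibre weights are as small as possible.

      module Tight (W≤2 : ∀ u → W u ≤ 2) (W≤1 : ∀ u → ¬ HasTwo u → W u ≤ 1) where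

        perfect : PerfectDominating G D
        perfect = zeros⇒perfectDominating λ u ¬two → weight<n⇒zero (a u) (≤-<-trans (W≤1 u ¬two) 1<n)

        DNeighbour : Fin m → Set
        DNeighbour u = ∃[ x ] (x ∈ D × u G.~ x)

        dNeighbour? : Decidable DNeighbour
        dNeighbour? u = any? λ x → (x ∈? D) ×-dec (u G.~? x)

        others-zero : ∀ {u h v} → a u h ≡ 2F → v ≢ h → a u v ≡ 0F
        others-zero {u} = single-two (a u) (W≤2 u)

        -- A zero `(u , v)` cannot be dominated from another fibre, so it is dominated by the only 2
        -- of its own, at `h`.
        no-neighbour⇒universal : ∀ {u h} → a u h ≡ 2F → ¬ DNeighbour u → Universal H h
        no-neighbour⇒universal {u} {h} uh≡2 ∄nb v v≢h
          with zero-dominated u v (others-zero uh≡2 v≢h)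
        ... | (x , y) , (inj₁ u~x , xy≡2) , _ =
          contradiction (x , ∈-subset⁺ hasTwo? (y , xy≡2) , u~x) ∄nb
        ... | (_ , y) , (inj₂ (refl , v~y) , uy≡2) , _ with y ≟ᶠ h
        ...   | yes refl = v~y
        ...   | no y≢h   = contradiction (trans (sym uy≡2) (others-zero uh≡2 y≢h)) λ ()

        -- If `v` were adjacent to `h`, the zero at `(u , v)` would be dominated both from its own
        -- fibre and from the fibre of `x`.
        neighbour⇒isolated : ∀ {u h} → a u h ≡ 2F → DNeighbour u → Isolated H h
        neighbour⇒isolated {u} {h} uh≡2 (x , x∈D , u~x) v v~h
          with y , xy≡2 ← ∈-subset⁻ hasTwo? x∈D =
          G.irr~ (zero-dominated! (others-zero uh≡2 λ { refl → H.irr~ refl v~h })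
                    (inj₂ (refl , v~h)) uh≡2 (inj₁ u~x) xy≡2) u~x

        -- Off `D` this is perfect domination. For `w` in `D`, the fibre of `w` still has a zero,
        -- and a 2 over each `D`-neighbour of `w` dominates it.
        neighbour-unique : ∀ {w u v} → u ∈ D → v ∈ D → w G.~ u → w G.~ v → u ≡ v
        neighbour-unique {w} u∈D v∈D w~u w~v with hasTwo? w
        ... | no ¬two with _ , _ , uniq ← perfect w (¬two ∘ ∈-subset⁻ hasTwo?) =
          trans (sym (uniq (u∈D , w~u))) (uniq (v∈D , w~v))
        ... | yes (h , wh≡2) =
          zero-dominated! (others-zero wh≡2 (proj₂ (another 1<n h)))
            (inj₁ w~u) (proj₂ (∈-subset⁻ hasTwo? u∈D)) (inj₁ w~v) (proj₂ (∈-subset⁻ hasTwo? v∈D))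

        -- The split is on whether some vertex of `D` has no neighbour in `D`. If so, `H` has a
        -- universal vertex, hence no isolated one, and `D` is independent; otherwise every vertex
        -- of `G` has a neighbour in `D`.
        efficient : Fin m → ((∃ (Universal H)) × IsEfficientClosed G D) ⊎ ((∃ (Isolated H)) × IsEfficientOpen G D)
        efficient w₀ with any? (λ u → (u ∈? D) ×-dec ¬? (dNeighbour? u))
        ... | yes (u , u∈D , ∄nb) with h , uh≡2 ← ∈-subset⁻ hasTwo? u∈D =
          inj₁ ((h , univ) , perfect⇒dominating G perfect , disjoint)
          where
          univ : Universal H h
          univ = no-neighbour⇒universal uh≡2 ∄nb
          independent : ∀ {v x} → v ∈ D → x ∈ D → ¬ (v G.~ x)
          independent v∈D x∈D v~x = universal⇒¬isolated H 1<n univ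
            (neighbour⇒isolated (proj₂ (∈-subset⁻ hasTwo? v∈D)) (_ , x∈D , v~x))
          disjoint : ∀ {v x} → v ∈ D → x ∈ D → v ≢ x → Empty (N[_] G v ∩ N[_] G x)
          disjoint {v} {x} v∈D x∈D v≢x (w , w∈)
            with w∈v , w∈x ← x∈p∩q⁻ (N[_] G v) (N[_] G x) w∈ | ∈N[]⁻ G w∈v | ∈N[]⁻ G w∈x
          ... | inj₁ v~w  | inj₁ x~w  = v≢x (neighbour-unique v∈D x∈D (G.sym~ v~w) (G.sym~ x~w))
          ... | inj₁ v~w  | inj₂ refl = independent v∈D x∈D v~w
          ... | inj₂ refl | inj₁ x~w  = independent x∈D v∈D x~w
          ... | inj₂ refl | inj₂ refl = v≢x refl
        ... | no all-nb = inj₂ ((_ , isol) , cover , disjoint)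
          where
          neighbour : ∀ v → DNeighbour v
          neighbour v with v ∈? D | dNeighbour? v
          ... | _       | yes nb = nb
          ... | yes v∈D | no ∄nb = contradiction (v , v∈D , ∄nb) all-nb
          ... | no v∉D  | no ∄nb = perfect⇒dominating G perfect v v∉D
          isol : Isolated H _
          -- The vertex `w₀` yields a member `u` of `D`; the position of the 2 in the fibre of `u`
          -- is the isolated vertex.
          isol = let u , u∈D , _ = neighbour w₀ in
            neighbour⇒isolated (proj₂ (∈-subset⁻ hasTwo? u∈D)) (neighbour u)
          cover : ∀ v → ∃[ u ] (u ∈ D × v ∈ N G u)
          cover v = let u , u∈D , v~u = neighbour v in u , u∈D , ~⇒∈N G (G.sym~ v~u)
          disjoint : ∀ {v x} → v ∈ D → x ∈ D → v ≢ x → Empty (N G v ∩ N G x)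
          disjoint {v} {x} v∈D x∈D v≢x (w , w∈) with w∈v , w∈x ← x∈p∩q⁻ (N G v) (N G x) w∈ =
            v≢x (neighbour-unique v∈D x∈D (G.sym~ (∈N⇒~ G w∈v)) (G.sym~ (∈N⇒~ G w∈x)))

        tight⇒𝒫 : .{{_ : NonTrivial n}} → Fin m → ∣ D ∣ ≤ γᵖ G → 𝒫₂ G H ⊎ 𝒫₃ G H
        tight⇒𝒫 w₀ ∣D∣≤γᵖ with efficient w₀
        ... | inj₁ ((h , univ) , eff) = inj₁ (universal⇒γ≡1 H univ , D , eff)
        ... | inj₂ ((h , isol) , eff) = inj₂
          (isolated⇒δ≡0 H {{nonTrivial⇒nonZero n}} isol , (D , eff) ,
           trans (≤-antisym (γᵖ≤ G perfect) ∣D∣≤γᵖ) (sym (efficientOpen⇒γₜ≡∣D∣ G eff _)))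

    γᵖR≤weight : γᵖR G ≤ weight f
    γᵖR≤weight = subst (γᵖR G ≤_) (sym (weight-fibres m f))
      (≤-trans (γᵖR≤ G collapse-PRDF) (sum-mono-≤ _ W collapse≤W))

    2γ≤weight : 2 * γ G ≤ weight f
    2γ≤weight = subst (2 * γ G ≤_) (sym (weight-fibres m f))
      (≤-trans (*-monoʳ-≤ 2 (γ≤ G heavy-dominating)) (2*∣S∣≤sum heavy W (∈-subset⁻ 2≤W?)))

    -- As `collapse` is a PRDF lying below `W`, it must equal `W`, and its values give the bounds
    -- for `Tight`. Then `2 * ∣ D ∣`, `γᵖR G` and `2 * γᵖ G` coincide.
    weight≤γᵖR⇒ : .{{_ : NonTrivial n}} → Fin m → weight f ≤ γᵖR G → γᵖR G ≡ 2 * γᵖ G × (𝒫₂ G H ⊎ 𝒫₃ G H)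
    weight≤γᵖR⇒ w₀ w≤ =
      ≤-antisym (γᵖR≤2γᵖ G) (≤-trans (*-monoʳ-≤ 2 (γᵖ≤ G perfect)) 2∣D∣≤γᵖR) ,
      tight⇒𝒫 w₀ (*-cancelˡ-≤ 2 (≤-trans 2∣D∣≤γᵖR (γᵖR≤2γᵖ G)))
      where
      ΣW≤γᵖR : sum W ≤ γᵖR G
      ΣW≤γᵖR = subst (_≤ γᵖR G) (weight-fibres m f) w≤
      collapse≡W : ∀ u → toℕ (collapse u) ≡ W u
      collapse≡W = sum-≤-≥⇒≗ _ W collapse≤W (≤-trans ΣW≤γᵖR (γᵖR≤ G collapse-PRDF))
      open Tight (λ u → subst (_≤ 2) (collapse≡W u) (toℕ≤pred[n] (collapse u)))
                 (λ u ¬two → subst (_≤ 1) (collapse≡W u) (collapse≤1 ¬two))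
      2∣D∣≤γᵖR : 2 * ∣ D ∣ ≤ γᵖR G
      2∣D∣≤γᵖR = ≤-trans (2*∣S∣≤sum D W D⇒2≤W) ΣW≤γᵖR

    -- Two squeezes: against `heavy` to bound every fibre weight by 2, which produces zeros and
    -- makes `D` dominating, then against `D` itself.
    weight≤2γ⇒ : .{{_ : NonTrivial n}} → Fin m → 3 ≤ n → weight f ≤ 2 * γ G → γᵖ G ≡ γ G × (𝒫₂ G H ⊎ 𝒫₃ G H)
    weight≤2γ⇒ w₀ 3≤n w≤ =
      ≤-antisym (≤-trans (γᵖ≤ G perfect) ∣D∣≤γ) (γ≤γᵖ G) , tight⇒𝒫 w₀ (≤-trans ∣D∣≤γ (γ≤γᵖ G))
      where
      ΣW≤2γ : sum W ≤ 2 * γ G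
      ΣW≤2γ = subst (_≤ 2 * γ G) (weight-fibres m f) w≤
      squeeze : ∀ S → Dominating G S → (∀ {u} → u ∈ S → 2 ≤ W u) → ∀ u → toℕ (romanOn S u) ≡ W u
      squeeze S dom 2≤W = sum≤2*∣S∣⇒≗ S W 2≤W (≤-trans ΣW≤2γ (*-monoʳ-≤ 2 (γ≤ G dom)))
      W≤2 : ∀ u → W u ≤ 2
      W≤2 u = subst (_≤ 2) (squeeze heavy heavy-dominating (∈-subset⁻ 2≤W?) u) (toℕ≤pred[n] (romanOn heavy u))
      -- For n = 2 a fibre of weight 2 may consist of two ones and so contain no zero.
      D-dominating : Dominating G D
      D-dominating = perfect⇒dominating G
        (zeros⇒perfectDominating λ u _ → weight<n⇒zero (a u) (<-≤-trans (s≤s (W≤2 u)) 3≤n))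
      W≤1 : ∀ u → ¬ HasTwo u → W u ≤ 1
      -- Off `D` the second squeeze even gives `W u ≡ 0`.
      W≤1 u ¬two = subst (_≤ 1)
        (trans (cong toℕ (sym (romanOn-∉ (¬two ∘ ∈-subset⁻ hasTwo?)))) (squeeze D D-dominating D⇒2≤W u)) z≤n
      open Tight W≤2 W≤1
      ∣D∣≤γ : ∣ D ∣ ≤ γ G
      ∣D∣≤γ = *-cancelˡ-≤ 2 (≤-trans (2*∣S∣≤sum D W D⇒2≤W) ΣW≤2γ)

theorem4p10 : ∀ {m n} .{{_ : NonTrivial m}} .{{_ : NonTrivial n}} (G : Graph m) (H : Graph n) →
    (γᵖR (G ⊚ H) ≥ γᵖR G ⊔ 2 * γ G) ×
    (γᵖR (G ⊚ H) ≡ γᵖR G ⇔ (γᵖR G ≡ 2 * γᵖ G × (𝒫₂ G H ⊎ 𝒫₃ G H))) ×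
    (3 ≤ n → γᵖR (G ⊚ H) ≡ 2 * γ G ⇔ (γᵖ G ≡ γ G × (𝒫₂ G H ⊎ 𝒫₃ G H)))
theorem4p10 {m} {n} G H with f , prdf , w≡ ← Minimum.attained (perfectRomanDomination (G ⊚ H)) =
  ⊔-lub γᵖR≤ᴳᴴ 2γ≤ᴳᴴ ,
  mk⇔ (λ eq → weight≤γᵖR⇒ G H 1<n f prdf w₀ (≤-reflexive (trans w≡ eq)))
      (λ (γᵖR≡ , 𝒫) → ≤-antisym (≤-trans (𝒫⇒γᵖR≤2γᵖ G H 𝒫) (≤-reflexive (sym γᵖR≡))) γᵖR≤ᴳᴴ) ,
  λ 3≤n →
  mk⇔ (λ eq → weight≤2γ⇒ G H 1<n f prdf w₀ 3≤n (≤-reflexive (trans w≡ eq)))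
      (λ (γᵖ≡γ , 𝒫) → ≤-antisym (subst (λ k → γᵖR (G ⊚ H) ≤ 2 * k) γᵖ≡γ (𝒫⇒γᵖR≤2γᵖ G H 𝒫)) 2γ≤ᴳᴴ)
  where
  1<n : 1 < n
  1<n = nonTrivial⇒n>1 n
  w₀ : Fin m
  w₀ = element (nonTrivial⇒n>1 m)
  γᵖR≤ᴳᴴ : γᵖR G ≤ γᵖR (G ⊚ H)
  γᵖR≤ᴳᴴ = subst (γᵖR G ≤_) w≡ (γᵖR≤weight G H 1<n f prdf)
  2γ≤ᴳᴴ : 2 * γ G ≤ γᵖR (G ⊚ H)
  2γ≤ᴳᴴ = subst (2 * γ G ≤_) w≡ (2γ≤weight G H 1<n f prdf)
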